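{- Let $\Sigma$ be an alphabet. The mapping $F$ sending a partial probabilistic system $(S,i,Supp,\mu)$ to its underlying transition system $(S,i,Supp)$, and a morphism to its underlying function, is a functor $F:\mathbf{Prob}_{\Sigma}\to\mathbf{TS}_{\Sigma}$, and this functor is a coreflection.
   Context: $\mathbf{TS}_{\Sigma}$: objects are transition systems $(S,i,\Delta)$ with $i\in S$, $\Delta\subseteq S\times\Sigma\times S$; morphisms are functions $f$ on states with $f(i)=i'$ and $(f(s),a,f(s'))\in\Delta'$ for all $(s,a,s')\in\Delta$. A partial probabilistic system is a quadruple $(S,i,Supp,\mu)$ where $(S,i,Supp)$ is a transition system (the support relation $Supp\subseteq S\times\Sigma\times S$) and $\mu:Supp\to[0,1]$ is such that for every $s\in S$ and $a\in\Sigma$, the set $\{t\mid\mu(s,a,t)>0\}$ is finite and $\sum_{(s,a,t)\in Supp}\mu(s,a,t)\le1$. A morphism $(S,i,Supp,\mu)\to(S',i',Supp',\mu')$ is a morphism $f$ of the underlying transition systems such that for every $(s,a,t)\in Supp$, $\sum_{(s,a,t')\in Supp,\ f(t')=f(t)}\mu(s,a,t')\le\mu'(f(s),a,f(t))$. These form the category $\mathbf{Prob}_{\Sigma}$. A functor is a coreflection if it is a right adjoint whose left adjoint is fully faithful (equivalently, a right adjoint whose adjunction unit is a natural isomorphism). -}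

module Defs where

open import Data.Empty using (⊥-elim)
import Data.Integer as ℤ
open import Data.List using (List; []; _∷_; map; foldr; length)
open import Data.List.Membership.Propositional using (_∈_)
open import Data.List.Relation.Binary.Sublist.Propositional using (_⊆_; []; _∷_; _∷ʳ_)
open import Data.List.Relation.Binary.Sublist.Propositional.Properties using (All-resp-⊆; length-mono-≤)
open import Data.List.Relation.Unary.All using (All; []; _∷_)
import Data.List.Relation.Unary.All.Properties as All
open import Data.List.Relation.Unary.AllPairs using ([]; _∷_)
open import Data.List.Relation.Unary.Unique.Propositional using (Unique)
open import Data.Nat as ℕ using (suc)
import Data.Nat.Properties as ℕ
open import Data.Product using (Σ; Σ-syntax; ∃; _×_; _,_; proj₁; proj₂)
open import Data.Rational as ℚ using (ℚ; 0ℚ; 1ℚ; ½; Positive)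
import Data.Rational.Properties as ℚ
open import Data.Rational.Solver using (module +-*-Solver)
open import Function using (_∘_; _⇔_; mk⇔)
open import Function.Definitions using (Bijective)
open import Level using (Level; _⊔_) renaming (suc to lsuc)
open import Relation.Binary using (Rel; IsEquivalence)
open import Relation.Binary.PropositionalEquality
  using (_≡_; _≢_; refl; sym; trans; cong; subst)
open import Relation.Nullary using (¬_; yes; no)
open import Relation.Nullary.Decidable using (¬¬-excluded-middle)

private
  variable
    a b ℓ o p h e o′ h′ e′ : Level

------------------------------------------------------------------------
-- Categories

-- Hom-sets are setoids, so that morphisms which are functions with
-- properties can be compared pointwise.

record Category (o h e : Level) : Set (lsuc (o ⊔ h ⊔ e)) where
  infix  4 _≈_ _⇒_
  infixr 9 _∙_
  field
    Obj : Set o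
    _⇒_ : Obj → Obj → Set h
    _≈_ : ∀ {X Y} → Rel (X ⇒ Y) e
    id  : ∀ {X} → X ⇒ X
    _∙_ : ∀ {X Y Z} → Y ⇒ Z → X ⇒ Y → X ⇒ Z

    equiv     : ∀ {X Y} → IsEquivalence (_≈_ {X} {Y})
    ∙-cong    : ∀ {X Y Z} {g g′ : Y ⇒ Z} {f f′ : X ⇒ Y} →
                g ≈ g′ → f ≈ f′ → g ∙ f ≈ g′ ∙ f′
    assoc     : ∀ {W X Y Z} (h : Y ⇒ Z) (g : X ⇒ Y) (f : W ⇒ X) →
                (h ∙ g) ∙ f ≈ h ∙ (g ∙ f)
    identityˡ : ∀ {X Y} (f : X ⇒ Y) → id ∙ f ≈ f
    identityʳ : ∀ {X Y} (f : X ⇒ Y) → f ∙ id ≈ f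

record IsFunctor (C : Category o h e) (D : Category o′ h′ e′)
                 (F₀ : Category.Obj C → Category.Obj D)
                 (F₁ : ∀ {X Y} → Category._⇒_ C X Y → Category._⇒_ D (F₀ X) (F₀ Y))
                 : Set (o ⊔ h ⊔ e ⊔ e′) where
  private
    module C = Category C
    module D = Category D
  field
    F-cong : ∀ {X Y} {f g : X C.⇒ Y} → f C.≈ g → F₁ f D.≈ F₁ g
    F-id   : ∀ {X} → F₁ (C.id {X}) D.≈ D.id
    F-∙    : ∀ {X Y Z} (g : Y C.⇒ Z) (f : X C.⇒ Y) → F₁ (g C.∙ f) D.≈ F₁ g D.∙ F₁ f

record Functor (C : Category o h e) (D : Category o′ h′ e′)
               : Set (o ⊔ h ⊔ e ⊔ o′ ⊔ h′ ⊔ e′) where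
  field
    F₀        : Category.Obj C → Category.Obj D
    F₁        : ∀ {X Y} → Category._⇒_ C X Y → Category._⇒_ D (F₀ X) (F₀ Y)
    isFunctor : IsFunctor C D F₀ F₁

  open IsFunctor isFunctor public

⟨_⟩ : {C : Category o h e} {D : Category o′ h′ e′}
      {F₀ : Category.Obj C → Category.Obj D}
      {F₁ : ∀ {X Y} → Category._⇒_ C X Y → Category._⇒_ D (F₀ X) (F₀ Y)} →
      IsFunctor C D F₀ F₁ → Functor C D
⟨ isFunctor ⟩ = record { isFunctor = isFunctor }

record _⊣_ {C : Category o h e} {D : Category o′ h′ e′}
           (L : Functor D C) (R : Functor C D)
           : Set (o ⊔ h ⊔ e ⊔ o′ ⊔ h′ ⊔ e′) where
  private
    module C = Category C
    module D = Category D
    module L = Functor L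
    module R = Functor R
  field
    unit           : ∀ X → X D.⇒ R.F₀ (L.F₀ X)
    unit-natural   : ∀ {X Y} (f : X D.⇒ Y) → unit Y D.∙ f D.≈ R.F₁ (L.F₁ f) D.∙ unit X
    counit         : ∀ X → L.F₀ (R.F₀ X) C.⇒ X
    counit-natural : ∀ {X Y} (f : X C.⇒ Y) → counit Y C.∙ L.F₁ (R.F₁ f) C.≈ f C.∙ counit X
    zig            : ∀ X → counit (L.F₀ X) C.∙ L.F₁ (unit X) C.≈ C.id
    zag            : ∀ X → R.F₁ (counit X) D.∙ unit (R.F₀ X) D.≈ D.id

FullyFaithful : {C : Category o h e} {D : Category o′ h′ e′} → Functor C D → Set _
FullyFaithful {C = C} {D = D} F =
  ∀ X Y → Bijective (Category._≈_ C) (Category._≈_ D) (Functor.F₁ F {X} {Y})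

IsCoreflection : {C : Category o h e} {D : Category o′ h′ e′} → Functor C D → Set _
IsCoreflection {C = C} {D = D} R = Σ[ L ∈ Functor D C ] (L ⊣ R) × FullyFaithful L

------------------------------------------------------------------------
-- Real numbers

-- Cauchy reals, as regular functions: `approx x ε` is within ε of x.

ℚ⁺ : Set
ℚ⁺ = ∃ Positive

half : ℚ⁺ → ℚ⁺
half (ε , ε>0) = ½ ℚ.* ε , ℚ.pos*pos⇒pos ½ ε {{ε>0}}

-- Exchanging ε and δ in `regular` gives ∣ approx ε - approx δ ∣ ≤ ε + δ.

record ℝ : Set where
  no-eta-equality
  field
    approx  : ℚ⁺ → ℚ
    regular : ∀ ε δ → approx ε ℚ.≤ approx δ ℚ.+ (proj₁ ε ℚ.+ proj₁ δ)

open ℝ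

infix  4 _<_ _≤_
infixl 6 _+_

_<_ : Rel ℝ _
x < y = Σ[ ε ∈ ℚ⁺ ] approx x ε ℚ.+ (proj₁ ε ℚ.+ proj₁ ε) ℚ.< approx y ε

_≤_ : Rel ℝ _
x ≤ y = ¬ (y < x)

fromℚ : ℚ → ℝ
approx  (fromℚ q) _ = q
regular (fromℚ q) (ε , ε>0) (δ , δ>0) = ℚ.<⇒≤
  (subst (ℚ._< q ℚ.+ (ε ℚ.+ δ)) (ℚ.+-identityʳ q)
    (ℚ.+-monoʳ-< q (ℚ.+-mono-< (ℚ.positive⁻¹ ε {{ε>0}}) (ℚ.positive⁻¹ δ {{δ>0}}))))

0ℝ 1ℝ : ℝ
0ℝ = fromℚ 0ℚ
1ℝ = fromℚ 1ℚ

private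
  open +-*-Solver

  +-regular : ∀ u v u′ v′ ε δ →
              u ℚ.≤ u′ ℚ.+ (½ ℚ.* ε ℚ.+ ½ ℚ.* δ) → v ℚ.≤ v′ ℚ.+ (½ ℚ.* ε ℚ.+ ½ ℚ.* δ) →
              u ℚ.+ v ℚ.≤ u′ ℚ.+ v′ ℚ.+ (ε ℚ.+ δ)
  +-regular u v u′ v′ ε δ p q =
    subst (u ℚ.+ v ℚ.≤_)
      (solve 4 (λ u′ v′ ε δ →
        (u′ :+ (con ½ :* ε :+ con ½ :* δ)) :+ (v′ :+ (con ½ :* ε :+ con ½ :* δ))
          := u′ :+ v′ :+ (ε :+ δ)) refl u′ v′ ε δ)
      (ℚ.+-mono-≤ p q)

_+_ : ℝ → ℝ → ℝ
approx  (x + y) ε   = approx x (half ε) ℚ.+ approx y (half ε)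
regular (x + y) ε δ = +-regular
  (approx x (half ε)) (approx y (half ε)) (approx x (half δ)) (approx y (half δ))
  (proj₁ ε) (proj₁ δ) (regular x (half ε) (half δ)) (regular y (half ε) (half δ))

sum : List ℝ → ℝ
sum = foldr _+_ 0ℝ

≤-pointwise : ∀ x y → (∀ ε → approx x ε ℚ.≤ approx y ε ℚ.+ (proj₁ ε ℚ.+ proj₁ ε)) → x ≤ y
≤-pointwise x y p (ε , q) = ℚ.<-irrefl refl (ℚ.<-≤-trans q (p ε))

≤-approx : ∀ x y → x ≤ y → ∀ ε → approx x ε ℚ.≤ approx y ε ℚ.+ (proj₁ ε ℚ.+ proj₁ ε)
≤-approx x y p ε = ℚ.≮⇒≥ (λ q → p (ε , q))

≤-stable : ∀ x y → ¬ ¬ (x ≤ y) → x ≤ y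
≤-stable x y p q = p (λ r → r q)

≤-refl : ∀ x → x ≤ x
≤-refl x = ≤-pointwise x x (λ ε → regular x ε ε)

≤-trans : ∀ x y z → x ≤ y → y ≤ z → x ≤ z
≤-trans x y z x≤y y≤z (ε⁺@(ε , _) , gap>0) = ℚ.<-irrefl refl (begin-strict
  X                                                   ≤⟨ regular x ε⁺ δ⁺ ⟩
  approx x δ⁺ ℚ.+ (ε ℚ.+ δ)                           ≤⟨ ℚ.+-monoˡ-≤ _ (≤-approx x y x≤y δ⁺) ⟩
  approx y δ⁺ ℚ.+ (δ ℚ.+ δ) ℚ.+ (ε ℚ.+ δ)             ≤⟨ ℚ.+-monoˡ-≤ _ (ℚ.+-monoˡ-≤ _ (≤-approx y z y≤z δ⁺)) ⟩
  approx z δ⁺ ℚ.+ (δ ℚ.+ δ) ℚ.+ (δ ℚ.+ δ) ℚ.+ (ε ℚ.+ δ)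
    ≤⟨ ℚ.+-monoˡ-≤ _ (ℚ.+-monoˡ-≤ _ (ℚ.+-monoˡ-≤ _ (regular z δ⁺ ε⁺))) ⟩
  Z ℚ.+ (δ ℚ.+ ε) ℚ.+ (δ ℚ.+ δ) ℚ.+ (δ ℚ.+ δ) ℚ.+ (ε ℚ.+ δ)
    ≡⟨ solve 3 (λ Z δ ε → Z :+ (δ :+ ε) :+ (δ :+ δ) :+ (δ :+ δ) :+ (ε :+ δ)
                        := Z :+ (ε :+ ε) :+ (δ :+ δ :+ δ :+ δ :+ δ :+ δ) :+ con 0ℚ) refl Z δ ε ⟩
  Z ℚ.+ (ε ℚ.+ ε) ℚ.+ (δ ℚ.+ δ ℚ.+ δ ℚ.+ δ ℚ.+ δ ℚ.+ δ) ℚ.+ 0ℚ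
    <⟨ ℚ.+-monoʳ-< (Z ℚ.+ (ε ℚ.+ ε) ℚ.+ (δ ℚ.+ δ ℚ.+ δ ℚ.+ δ ℚ.+ δ ℚ.+ δ)) (ℚ.+-mono-< δ>0 δ>0) ⟩
  Z ℚ.+ (ε ℚ.+ ε) ℚ.+ (δ ℚ.+ δ ℚ.+ δ ℚ.+ δ ℚ.+ δ ℚ.+ δ) ℚ.+ (δ ℚ.+ δ)
    ≡⟨ solve 3 (λ X Z ε →
         let δ = con ⅛ :* (X :- (Z :+ (ε :+ ε))) in
         Z :+ (ε :+ ε) :+ (δ :+ δ :+ δ :+ δ :+ δ :+ δ) :+ (δ :+ δ) := X) refl X Z ε ⟩
  X ∎)
  where
  open ℚ.≤-Reasoning
  ⅛ = ℤ.+ 1 ℚ./ 8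
  X = approx x ε⁺
  Z = approx z ε⁺
  gap = X ℚ.- (Z ℚ.+ (ε ℚ.+ ε))
  δ = ⅛ ℚ.* gap

  gap⁺ : Positive gap
  gap⁺ = ℚ.positive (subst (ℚ._< gap) (ℚ.+-inverseʳ (Z ℚ.+ (ε ℚ.+ ε)))
                       (ℚ.+-monoˡ-< (ℚ.- (Z ℚ.+ (ε ℚ.+ ε))) gap>0))

  δ⁺ : ℚ⁺
  δ⁺ = δ , ℚ.pos*pos⇒pos ⅛ gap {{gap⁺}}

  δ>0 : 0ℚ ℚ.< δ
  δ>0 = ℚ.positive⁻¹ δ {{proj₂ δ⁺}}

+-mono-≤ : ∀ x y u v → x ≤ y → u ≤ v → x + u ≤ y + v
+-mono-≤ x y u v p q = ≤-pointwise (x + u) (y + v) λ ε →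
  +-regular
    (approx x (half ε)) (approx u (half ε)) (approx y (half ε)) (approx v (half ε))
    (proj₁ ε) (proj₁ ε) (≤-approx x y p (half ε)) (≤-approx u v q (half ε))

+-identityʳ-≤ : ∀ x → x + 0ℝ ≤ x
+-identityʳ-≤ x = ≤-pointwise (x + 0ℝ) x λ ε⁺@(ε , ε>0) → begin
  approx x (half ε⁺) ℚ.+ 0ℚ              ≡⟨ ℚ.+-identityʳ _ ⟩
  approx x (half ε⁺)                     ≤⟨ regular x (half ε⁺) ε⁺ ⟩
  approx x ε⁺ ℚ.+ (½ ℚ.* ε ℚ.+ ε)        ≤⟨ ℚ.+-monoʳ-≤ (approx x ε⁺) (ℚ.+-monoˡ-≤ ε (½-shrinks ε ε>0)) ⟩
  approx x ε⁺ ℚ.+ (ε ℚ.+ ε)              ∎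
  where
  open ℚ.≤-Reasoning
  ½-shrinks : ∀ ε → Positive ε → ½ ℚ.* ε ℚ.≤ ε
  ½-shrinks ε ε>0 = begin
    ½ ℚ.* ε             ≡⟨ sym (ℚ.+-identityʳ _) ⟩
    ½ ℚ.* ε ℚ.+ 0ℚ      ≤⟨ ℚ.+-monoʳ-≤ (½ ℚ.* ε) (ℚ.<⇒≤ (ℚ.positive⁻¹ _ {{proj₂ (half (ε , ε>0))}})) ⟩
    ½ ℚ.* ε ℚ.+ ½ ℚ.* ε ≡⟨ solve 1 (λ ε → con ½ :* ε :+ con ½ :* ε := ε) refl ε ⟩
    ε                   ∎

private
  regroup : ∀ X X′ Y Y′ Z Z′ ε → 0ℚ ℚ.≤ ε →
            X ℚ.≤ X′ ℚ.+ (½ ℚ.* ε ℚ.+ ½ ℚ.* (½ ℚ.* ε)) →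
            Y ℚ.≤ Y′ ℚ.+ (½ ℚ.* ε ℚ.+ ½ ℚ.* (½ ℚ.* ε)) →
            Z ℚ.≤ Z′ →
            (X ℚ.+ Y) ℚ.+ Z ℚ.≤ (X′ ℚ.+ Y′) ℚ.+ Z′ ℚ.+ (ε ℚ.+ ε)
  regroup X X′ Y Y′ Z Z′ ε ε≥0 p q r = begin
    X ℚ.+ Y ℚ.+ Z
      ≤⟨ ℚ.+-mono-≤ (ℚ.+-mono-≤ p q) r ⟩
    (X′ ℚ.+ (½ ℚ.* ε ℚ.+ ½ ℚ.* (½ ℚ.* ε))) ℚ.+ (Y′ ℚ.+ (½ ℚ.* ε ℚ.+ ½ ℚ.* (½ ℚ.* ε))) ℚ.+ Z′
      ≡⟨ solve 4 (λ X′ Y′ Z′ ε →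
           (X′ :+ (con ½ :* ε :+ con ½ :* (con ½ :* ε))) :+ (Y′ :+ (con ½ :* ε :+ con ½ :* (con ½ :* ε))) :+ Z′
             := (X′ :+ Y′) :+ Z′ :+ (ε :+ con ½ :* ε)) refl X′ Y′ Z′ ε ⟩
    X′ ℚ.+ Y′ ℚ.+ Z′ ℚ.+ (ε ℚ.+ ½ ℚ.* ε)
      ≤⟨ ℚ.+-monoʳ-≤ (X′ ℚ.+ Y′ ℚ.+ Z′) (ℚ.+-monoʳ-≤ ε (subst (½ ℚ.* ε ℚ.≤_) (ℚ.*-identityˡ ε)
           (ℚ.*-monoʳ-≤-nonNeg ε {{ℚ.nonNegative ε≥0}} (ℚ.≤ᵇ⇒≤ {½} {1ℚ} _)))) ⟩
    X′ ℚ.+ Y′ ℚ.+ Z′ ℚ.+ (ε ℚ.+ ε) ∎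
    where open ℚ.≤-Reasoning

  ε≥0 : ∀ (ε : ℚ⁺) → 0ℚ ℚ.≤ proj₁ ε
  ε≥0 (ε , ε>0) = ℚ.<⇒≤ (ℚ.positive⁻¹ ε {{ε>0}})

+-assoc-≤ : ∀ x y z → x + (y + z) ≤ (x + y) + z
+-assoc-≤ x y z = ≤-pointwise (x + (y + z)) ((x + y) + z) λ ε →
  let h = half ε
      q = half h
      open ℚ.≤-Reasoning
  in begin
  approx x h ℚ.+ (approx y q ℚ.+ approx z q)
    ≡⟨ solve 3 (λ X Y Z → X :+ (Y :+ Z) := X :+ Z :+ Y) refl (approx x h) (approx y q) (approx z q) ⟩
  approx x h ℚ.+ approx z q ℚ.+ approx y q
    ≤⟨ regroup (approx x h) (approx x q) (approx z q) (approx z h) (approx y q) (approx y q)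
         (proj₁ ε) (ε≥0 ε) (regular x h q)
         (subst (λ η → approx z q ℚ.≤ approx z h ℚ.+ η) (ℚ.+-comm (proj₁ q) (proj₁ h)) (regular z q h))
         ℚ.≤-refl ⟩
  approx x q ℚ.+ approx z h ℚ.+ approx y q ℚ.+ (proj₁ ε ℚ.+ proj₁ ε)
    ≡⟨ solve 4 (λ X Y Z E → X :+ Z :+ Y :+ E := X :+ Y :+ Z :+ E) refl
         (approx x q) (approx y q) (approx z h) (proj₁ ε ℚ.+ proj₁ ε) ⟩
  approx x q ℚ.+ approx y q ℚ.+ approx z h ℚ.+ (proj₁ ε ℚ.+ proj₁ ε) ∎

+-comm-≤ : ∀ x y → x + y ≤ y + x
+-comm-≤ x y = ≤-pointwise (x + y) (y + x) λ ε →
  subst (ℚ._≤ approx (y + x) ε ℚ.+ (proj₁ ε ℚ.+ proj₁ ε))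
    (ℚ.+-comm (approx y (half ε)) (approx x (half ε)))
    (regular (y + x) ε ε)

+-swap-≤ : ∀ x y z → x + (y + z) ≤ y + (x + z)
+-swap-≤ x y z =
  ≤-trans (x + (y + z)) ((y + z) + x) (y + (x + z)) (+-comm-≤ x (y + z))
  (≤-trans ((y + z) + x) ((z + y) + x) (y + (x + z))
    (+-mono-≤ (y + z) (z + y) x x (+-comm-≤ y z) (≤-refl x))
  (≤-trans ((z + y) + x) (x + (z + y)) (y + (x + z)) (+-comm-≤ (z + y) x)
  (≤-trans (x + (z + y)) ((x + z) + y) (y + (x + z)) (+-assoc-≤ x z y)
           (+-comm-≤ (x + z) y))))

------------------------------------------------------------------------
-- Sums of families of nonnegative reals

module _ {I : Set a} (P : I → Set p) (w : ∀ i → .(P i) → ℝ) where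

  partialSum : List (∃ P) → ℝ
  partialSum xs = sum (map (λ (i , p) → w i p) xs)

  -- "The sum of all w i with P i is at most c", for w nonnegative. The sum
  -- is the supremum of the sums over finite subsets, and a supremum is at
  -- most c exactly when c is an upper bound (sumAtMost⇔sum≤). For finitely
  -- many nonzero terms this is the ordinary sum, but listing the terms with
  -- P i would require deciding P, e.g. f t′ ≡ f t for arbitrary states.

  SumAtMost : ℝ → Set _
  SumAtMost c = ∀ xs → Unique (map proj₁ xs) → partialSum xs ≤ c

  IsSum : ℝ → Set _
  IsSum s = SumAtMost s × (∀ c → SumAtMost c → s ≤ c)

  sumAtMost⇔sum≤ : ∀ {s} → IsSum s → ∀ c → SumAtMost c ⇔ s ≤ c
  sumAtMost⇔sum≤ {s} (bound , least) c = mk⇔ (least c) λ s≤c xs unique →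
    ≤-trans (partialSum xs) s c (bound xs unique) s≤c

Finite : {I : Set a} → (I → Set p) → Set _
Finite P = ∃ λ xs → ∀ i → P i ⇔ i ∈ xs

private
  Unique-⊆ : ∀ {I : Set a} {P : I → Set p} {xs ys : List (∃ P)} →
             ys ⊆ xs → Unique (map proj₁ xs) → Unique (map proj₁ ys)
  Unique-⊆ []             _            = []
  Unique-⊆ (_ ∷ʳ ys⊆xs)   (_ ∷ unique) = Unique-⊆ ys⊆xs unique
  Unique-⊆ (refl ∷ ys⊆xs) (x∉ ∷ unique) =
    All.map⁺ (All-resp-⊆ ys⊆xs (All.map⁻ x∉)) ∷ Unique-⊆ ys⊆xs unique

sumAtMost-restrict : {I : Set a} {P Q : I → Set p} {w : ∀ i → .(P i) → ℝ} (c : ℝ)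
                     (φ : ∀ i → Q i → P i) →
                     SumAtMost P w c → SumAtMost Q (λ i q → w i (φ i q)) c
sumAtMost-restrict {P = P} {Q} {w} c φ bound xs unique =
  subst (_≤ c) (same-sum xs) (bound (restrict xs) (subst Unique (sym (same-index xs)) unique))
  where
  restrict : List (∃ Q) → List (∃ P)
  restrict = map λ (i , q) → i , φ i q

  same-index : ∀ xs → map proj₁ (restrict xs) ≡ map proj₁ xs
  same-index []       = refl
  same-index (x ∷ xs) = cong (proj₁ x ∷_) (same-index xs)

  same-sum : ∀ xs → partialSum P w (restrict xs) ≡ partialSum Q (λ i q → w i (φ i q)) xs
  same-sum []             = refl
  same-sum ((i , q) ∷ xs) = cong (w i (φ i q) +_) (same-sum xs)

-- If every fibre of f weighs at most its image point, then the domain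
-- weighs at most the codomain. Grouping a list by its image under f needs
-- equality to be decidable, but only up to double negation, since _≤_ is
-- stable.

module _ {I : Set a} {J : Set b} {P : I → Set p} {Q : J → Set p}
         {w : ∀ i → .(P i) → ℝ} {v : ∀ j → .(Q j) → ℝ}
         (f : I → J) (f-resp : ∀ i → P i → Q (f i))
         (fibre : ∀ i (p : P i) →
                  SumAtMost (λ i′ → P i′ × f i′ ≡ f i) (λ i′ q → w i′ (proj₁ q))
                            (v (f i) (f-resp i p)))
         where
  private
    W = partialSum P w
    V = partialSum Q v

    record Split (j : J) (xs : List (∃ P)) : Set (a ⊔ b ⊔ p) where
      field
        {inside outside} : List (∃ P)
        inside⊆    : inside ⊆ xs
        outside⊆   : outside ⊆ xs
        inside-≡   : All (λ x → f (proj₁ x) ≡ j) inside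
        outside-≢  : All (λ x → j ≢ f (proj₁ x)) outside
        sum≤       : W xs ≤ W inside + W outside

    split : ∀ j xs → ¬ ¬ Split j xs
    split j [] k = k record
      { inside⊆ = [] ; outside⊆ = [] ; inside-≡ = [] ; outside-≢ = []
      ; sum≤ = ≤-pointwise 0ℝ (0ℝ + 0ℝ) (≤-approx 0ℝ 0ℝ (≤-refl 0ℝ)) }
    split j (x@(i , p) ∷ xs) k = split j xs λ where
      record { inside = ys ; outside = zs ; inside⊆ = ys⊆ ; outside⊆ = zs⊆
             ; inside-≡ = ys≡ ; outside-≢ = zs≢ ; sum≤ = W≤ } →
        let W≤′ = +-mono-≤ (w i p) (w i p) (W xs) (W ys + W zs) (≤-refl (w i p)) W≤ in
        ¬¬-excluded-middle λ where
          (yes fi≡j) → k record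
            { inside⊆ = refl ∷ ys⊆ ; outside⊆ = x ∷ʳ zs⊆
            ; inside-≡ = fi≡j ∷ ys≡ ; outside-≢ = zs≢
            ; sum≤ = ≤-trans (W (x ∷ xs)) (w i p + (W ys + W zs)) (W (x ∷ ys) + W zs)
                       W≤′ (+-assoc-≤ (w i p) (W ys) (W zs)) }
          (no fi≢j) → k record
            { inside⊆ = x ∷ʳ ys⊆ ; outside⊆ = refl ∷ zs⊆
            ; inside-≡ = ys≡ ; outside-≢ = (fi≢j ∘ sym) ∷ zs≢
            ; sum≤ = ≤-trans (W (x ∷ xs)) (w i p + (W ys + W zs)) (W ys + W (x ∷ zs))
                       W≤′ (+-swap-≤ (w i p) (W ys) (W zs)) }

    fibre-bound : ∀ i (p : P i) {ys} → Unique (map proj₁ ys) →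
                  All (λ y → f (proj₁ y) ≡ f i) ys → W ys ≤ v (f i) (f-resp i p)
    fibre-bound i p unique eqs =
      subst (_≤ v (f i) (f-resp i p)) (same-sum eqs)
        (fibre i p (tag eqs) (subst Unique (sym (same-index eqs)) unique))
      where
      Fibre = λ i′ → P i′ × f i′ ≡ f i

      tag : ∀ {ys} → All (λ y → f (proj₁ y) ≡ f i) ys → List (∃ Fibre)
      tag []                          = []
      tag (_∷_ {x = i′ , p′} eq eqs) = (i′ , p′ , eq) ∷ tag eqs

      same-index : ∀ {ys} (eqs : All _ ys) → map proj₁ (tag eqs) ≡ map proj₁ ys
      same-index []                         = refl
      same-index (_∷_ {x = i′ , p′} eq eqs) = cong (i′ ∷_) (same-index eqs)

      same-sum : ∀ {ys} (eqs : All _ ys) →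
                 partialSum Fibre (λ i′ q → w i′ (proj₁ q)) (tag eqs) ≡ W ys
      same-sum []                         = refl
      same-sum (_∷_ {x = i′ , p′} eq eqs) = cong (w i′ p′ +_) (same-sum eqs)

    record Image (xs : List (∃ P)) : Set (a ⊔ lsuc b ⊔ p) where
      field
        points  : List (∃ Q)
        unique  : Unique (map proj₁ points)
        inherit : ∀ (R : J → Set b) → All (λ x → R (f (proj₁ x))) xs → All R (map proj₁ points)
        sum≤    : W xs ≤ V points

    image : ∀ n xs → length xs ℕ.≤ n → Unique (map proj₁ xs) → ¬ ¬ Image xs
    image n [] _ _ k = k record
      { points = [] ; unique = [] ; inherit = λ _ _ → [] ; sum≤ = ≤-refl 0ℝ }
    image (suc n) (x@(i , p) ∷ xs) (ℕ.s≤s len) xs! k = split (f i) xs λ where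
      record { inside = ys ; outside = zs ; inside⊆ = ys⊆ ; outside⊆ = zs⊆
             ; inside-≡ = ys≡ ; outside-≢ = zs≢ ; sum≤ = W≤ } →
        image n zs (ℕ.≤-trans (length-mono-≤ zs⊆) len) (Unique-⊆ (x ∷ʳ zs⊆) xs!) λ where
          record { points = us ; unique = us! ; inherit = inherit ; sum≤ = Wzs≤ } → k record
            { points  = (f i , f-resp i p) ∷ us
            ; unique  = inherit (f i ≢_) zs≢ ∷ us!
            ; inherit = λ R → λ { (r ∷ rs) → r ∷ inherit R (All-resp-⊆ zs⊆ rs) }
            ; sum≤    =
                ≤-trans (W (x ∷ xs)) (w i p + (W ys + W zs)) (v (f i) (f-resp i p) + V us)
                  (+-mono-≤ (w i p) (w i p) (W xs) (W ys + W zs) (≤-refl (w i p)) W≤)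
                (≤-trans (w i p + (W ys + W zs)) (W (x ∷ ys) + W zs) (v (f i) (f-resp i p) + V us)
                  (+-assoc-≤ (w i p) (W ys) (W zs))
                  (+-mono-≤ (W (x ∷ ys)) (v (f i) (f-resp i p)) (W zs) (V us)
                    (fibre-bound i p {x ∷ ys} (Unique-⊆ {xs = x ∷ xs} {x ∷ ys} (refl ∷ ys⊆) xs!) (refl ∷ ys≡)) Wzs≤))
            }

  sumAtMost-pullback : ∀ c → SumAtMost Q v c → SumAtMost P w c
  sumAtMost-pullback c bound xs xs! = ≤-stable (W xs) c λ k →
    image (length xs) xs ℕ.≤-refl xs! λ img →
      let open Image img in k (≤-trans (W xs) (V points) c sum≤ (bound points unique))

------------------------------------------------------------------------
-- Transition systems

record TransitionSystem (A : Set a) (ℓ : Level) : Set (a ⊔ lsuc ℓ) where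
  field
    State : Set ℓ
    init  : State
    Trans : State → A → State → Set ℓ

record TSMorphism {A : Set a} (X Y : TransitionSystem A ℓ) : Set (a ⊔ ℓ) where
  private
    module X = TransitionSystem X
    module Y = TransitionSystem Y
  field
    fun        : X.State → Y.State
    fun-init   : fun X.init ≡ Y.init
    fun-trans  : ∀ {s a t} → X.Trans s a t → Y.Trans (fun s) a (fun t)

open TSMorphism

module _ {A : Set a} where

  idᵀ : {X : TransitionSystem A ℓ} → TSMorphism X X
  idᵀ = record { fun = λ s → s ; fun-init = refl ; fun-trans = λ p → p }

  _∘ᵀ_ : {X Y Z : TransitionSystem A ℓ} → TSMorphism Y Z → TSMorphism X Y → TSMorphism X Z
  g ∘ᵀ f = record
    { fun       = λ s → fun g (fun f s)
    ; fun-init  = trans (cong (fun g) (fun-init f)) (fun-init g)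
    ; fun-trans = λ p → fun-trans g (fun-trans f p)
    }

  infix 4 _≗ᵀ_

  _≗ᵀ_ : {X Y : TransitionSystem A ℓ} → Rel (TSMorphism X Y) ℓ
  f ≗ᵀ g = ∀ s → fun f s ≡ fun g s

TS : (A : Set a) (ℓ : Level) → Category _ _ _
TS A ℓ = record
  { Obj       = TransitionSystem A ℓ
  ; _⇒_       = TSMorphism
  ; _≈_       = _≗ᵀ_
  ; id        = idᵀ
  ; _∙_       = _∘ᵀ_
  ; equiv     = record
    { refl  = λ _ → refl
    ; sym   = λ f≗g s → sym (f≗g s)
    ; trans = λ f≗g g≗h s → trans (f≗g s) (g≗h s)
    }
  ; ∙-cong    = λ {_} {_} {_} {g} g≗g′ f≗f′ s → trans (cong (fun g) (f≗f′ s)) (g≗g′ _)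
  ; assoc     = λ _ _ _ _ → refl
  ; identityˡ = λ _ _ → refl
  ; identityʳ = λ _ _ → refl
  }

------------------------------------------------------------------------
-- Partial probabilistic systems

record ProbSystem (A : Set a) (ℓ : Level) : Set (a ⊔ lsuc ℓ) where
  field
    system : TransitionSystem A ℓ

  open TransitionSystem system public renaming (Trans to Supp)

  -- Supp is a subset, so the value of μ may not depend on the proof of
  -- membership.

  field
    μ       : ∀ s a t → .(Supp s a t) → ℝ
    0≤μ     : ∀ s a t (p : Supp s a t) → 0ℝ ≤ μ s a t p
    μ≤1     : ∀ s a t (p : Supp s a t) → μ s a t p ≤ 1ℝ
    finite  : ∀ s a → Finite (λ t → Σ[ p ∈ Supp s a t ] 0ℝ < μ s a t p)
    total≤1 : ∀ s a → SumAtMost (Supp s a) (μ s a) 1ℝ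

record ProbMorphism {A : Set a} (X Y : ProbSystem A ℓ) : Set (a ⊔ ℓ) where
  private
    module X = ProbSystem X
    module Y = ProbSystem Y
  field
    morphism : TSMorphism X.system Y.system

  private
    f = fun morphism

  field
    fibre≤ : ∀ s a t (p : X.Supp s a t) →
             SumAtMost (λ t′ → X.Supp s a t′ × f t′ ≡ f t)
                       (λ t′ q → X.μ s a t′ (proj₁ q))
                       (Y.μ (f s) a (f t) (fun-trans morphism p))

open ProbMorphism

module _ {A : Set a} where

  idᴾ : {X : ProbSystem A ℓ} → ProbMorphism X X
  idᴾ {X = X} = record
    { morphism = idᵀ
    ; fibre≤   = λ where
        s a t p [] _ → 0≤μ s a t p
        s a t p ((_ , _ , refl) ∷ []) _ → +-identityʳ-≤ (μ s a t p)
        s a t p ((_ , _ , t₁≡t) ∷ (_ , _ , t₂≡t) ∷ _) ((t₁≢t₂ ∷ _) ∷ _) →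
          ⊥-elim (t₁≢t₂ (trans t₁≡t (sym t₂≡t)))
    }
    where open ProbSystem X

  _∘ᴾ_ : {X Y Z : ProbSystem A ℓ} → ProbMorphism Y Z → ProbMorphism X Y → ProbMorphism X Z
  _∘ᴾ_ {X = X} {Y} {Z} g f = record
    { morphism = morphism g ∘ᵀ morphism f
    ; fibre≤   = λ s a t p →
        sumAtMost-pullback
          {w = λ t′ q → X.μ s a t′ (proj₁ q)}
          {v = λ u q → Y.μ (f₀ s) a u (proj₁ q)}
          f₀
          (λ _ (q , eq) → fun-trans (morphism f) q , eq)
          (λ t′ (q , _) → sumAtMost-restrict
            {w = λ t″ r → X.μ s a t″ (proj₁ r)}
            (Y.μ (f₀ s) a (f₀ t′) (fun-trans (morphism f) q))
            (λ _ ((r , _) , eq) → r , eq) (fibre≤ f s a t′ q))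
          (Z.μ (fun (morphism g) (f₀ s)) a (fun (morphism g) (f₀ t)) _)
          (fibre≤ g (f₀ s) a (f₀ t) (fun-trans (morphism f) p))
    }
    where
    module X = ProbSystem X
    module Y = ProbSystem Y
    module Z = ProbSystem Z
    f₀ = fun (morphism f)

Prob : (A : Set a) (ℓ : Level) → Category _ _ _
Prob A ℓ = record
  { Obj       = ProbSystem A ℓ
  ; _⇒_       = ProbMorphism
  ; _≈_       = λ f g → morphism f ≗ᵀ morphism g
  ; id        = idᴾ
  ; _∙_       = _∘ᴾ_
  ; equiv     = record
    { refl  = λ _ → refl
    ; sym   = λ f≗g s → sym (f≗g s)
    ; trans = λ f≗g g≗h s → trans (f≗g s) (g≗h s)
    }
  ; ∙-cong    = λ {_} {_} {_} {g} g≗g′ f≗f′ s →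
      trans (cong (fun (morphism g)) (f≗f′ s)) (g≗g′ _)
  ; assoc     = λ _ _ _ _ → refl
  ; identityˡ = λ _ _ → refl
  ; identityʳ = λ _ _ → refl
  }

{-# OPTIONS --safe #-}

-- The left adjoint gives every transition the weight zero. Out of such a
-- system the fibre inequality reads 0 ≤ μ′, so its morphisms in Prob are
-- exactly the morphisms of the underlying transition systems.

module Submission where

open import Defs using (IsFunctor; ⟨_⟩; IsCoreflection; TS; Prob; ProbSystem; ProbMorphism)
open import Defs using
  ( Functor; _⊣_; FullyFaithful; TransitionSystem; TSMorphism; idᵀ
  ; ℝ; 0ℝ; 1ℝ; _≤_; _+_; SumAtMost; partialSum
  ; ≤-pointwise; ≤-refl; ≤-trans; +-mono-≤; +-identityʳ-≤ )
open import Data.List using ([]; _∷_)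
open import Data.Product using (Σ-syntax; _,_; proj₁)
import Data.Rational as ℚ
import Data.Rational.Properties as ℚ
open import Function using (mk⇔)
open import Level using (Level)
open import Relation.Binary.PropositionalEquality using (refl)
open import Relation.Nullary using (contradiction)

private
  variable
    a p ℓ : Level

0≤1 : 0ℝ ≤ 1ℝ
0≤1 = ≤-pointwise 0ℝ 1ℝ λ ε →
  -- Regularity of `0ℝ` at `ε`, `ε` already says that 0 ≤ 0 + (ε + ε).
  ℚ.≤-trans (ℝ.regular 0ℝ ε ε) (ℚ.+-monoˡ-≤ (proj₁ ε ℚ.+ proj₁ ε) (ℚ.≤ᵇ⇒≤ {ℚ.0ℚ} {ℚ.1ℚ} _))

-- Induction on the list: `0ℝ + 0ℝ` is not literally `0ℝ`, so zeros are absorbed only up to `_≤_`.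
-- Used with `c` the total mass 1 and with `c` the weight of an image transition.
sumAtMost-zero : {I : Set a} (P : I → Set p) (c : ℝ) →
                 0ℝ ≤ c → SumAtMost P (λ _ _ → 0ℝ) c
sumAtMost-zero P c 0≤c xs _ = ≤-trans (S xs) 0ℝ c (sum≤0 xs) 0≤c
  where
  S = partialSum P (λ _ _ → 0ℝ)

  sum≤0 : ∀ xs → S xs ≤ 0ℝ
  sum≤0 []       = ≤-refl 0ℝ
  sum≤0 (_ ∷ xs) = ≤-trans (0ℝ + S xs) (0ℝ + 0ℝ) 0ℝ
    (+-mono-≤ 0ℝ 0ℝ (S xs) 0ℝ (≤-refl 0ℝ) (sum≤0 xs)) (+-identityʳ-≤ 0ℝ)

module _ {A : Set a} where

  zeroSystem : TransitionSystem A ℓ → ProbSystem A ℓ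
  zeroSystem X = record
    { system  = X
    ; μ       = λ _ _ _ _ → 0ℝ
    ; 0≤μ     = λ _ _ _ _ → ≤-refl 0ℝ
    ; μ≤1     = λ _ _ _ _ → 0≤1
    -- No weight is positive: `_≤_` is the negation of the reversed `_<_`, so reflexivity refutes 0
    -- < 0.
    ; finite  = λ _ _ → [] , λ _ → mk⇔ (λ (_ , 0<0) → contradiction 0<0 (≤-refl 0ℝ)) λ ()
    ; total≤1 = λ s a → sumAtMost-zero (TransitionSystem.Trans X s a) 1ℝ 0≤1
    }

  -- Transposition across the adjunction; it gives both the left adjoint on morphisms and, at `idᵀ`,
  -- the counit.
  fromZero : {X : TransitionSystem A ℓ} {Y : ProbSystem A ℓ} →
             TSMorphism X (ProbSystem.system Y) → ProbMorphism (zeroSystem X) Y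
  fromZero {Y = Y} f = record
    { morphism = f
    ; fibre≤   = λ s a t q → sumAtMost-zero _
        (μ (fun s) a (fun t) (fun-trans q)) (0≤μ (fun s) a (fun t) (fun-trans q))
    }
    where
    open ProbSystem Y
    open TSMorphism f

underlying-isFunctor : (ℓ : Level) (A : Set a) →
  IsFunctor (Prob A ℓ) (TS A ℓ) ProbSystem.system ProbMorphism.morphism
underlying-isFunctor ℓ A = record
  { F-cong = λ f≗g → f≗g
  ; F-id   = λ _ → refl
  ; F-∙    = λ _ _ _ → refl
  }

zeroFunctor : (ℓ : Level) (A : Set a) → Functor (TS A ℓ) (Prob A ℓ)
zeroFunctor ℓ A = record
  { F₀        = zeroSystem
  ; F₁        = fromZero
  ; isFunctor = record
    { F-cong = λ f≗g → f≗g
    ; F-id   = λ _ → refl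
    ; F-∙    = λ _ _ _ → refl
    }
  }

-- Forgetting the zero weights returns the very same transition system, so the unit is the identity
-- and all laws hold by computation.
zero⊣underlying : (ℓ : Level) (A : Set a) → zeroFunctor ℓ A ⊣ ⟨ underlying-isFunctor ℓ A ⟩
zero⊣underlying ℓ A = record
  { unit           = λ _ → idᵀ
  ; unit-natural   = λ _ _ → refl
  ; counit         = λ _ → fromZero idᵀ
  ; counit-natural = λ _ _ → refl
  ; zig            = λ _ _ → refl
  ; zag            = λ _ _ → refl
  }

zeroFunctor-fullyFaithful : (ℓ : Level) (A : Set a) → FullyFaithful (zeroFunctor ℓ A)
zeroFunctor-fullyFaithful ℓ A X Y =
  -- The preimage of `g` is its underlying morphism, since equality in `Prob` compares only
  -- underlying functions.
  (λ f≗g → f≗g) , λ g → ProbMorphism.morphism g , λ f≗g → f≗g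

theorem2 : ∀ {a : Level} (ℓ : Level) (A : Set a) →
    Σ[ F ∈ IsFunctor (Prob A ℓ) (TS A ℓ) ProbSystem.system ProbMorphism.morphism ]
    IsCoreflection ⟨ F ⟩
theorem2 ℓ A =
  underlying-isFunctor ℓ A ,
  zeroFunctor ℓ A , zero⊣underlying ℓ A , zeroFunctor-fullyFaithful ℓ A
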